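{- Let $k$ be a positive integer, let $G$ be an $n$-vertex graph, and let $(M,x)\in\mathcal{M}_k(G)$. Then the following statements hold: (1) For any $k$-independent set $S$ of $G$, $$|S|^2\leq x^\top M^\#x\sum_{u\in S}\frac{(M)_{uu}}{x_u^2}.$$ (2) The $k$-independence number $\alpha_k(G)$ satisfies $$\alpha_k(G)\leq x^\top M^\#x\max_{u\in V(G)}\frac{(M)_{uu}}{x_u^2}.$$ (3) For any $k$-distance coloring $V(G)=V_1\cup\cdots\cup V_t$ of $G$, $$\sum_{i=1}^t|V_i|^2\leq x^\top M^\#x\sum_{u\in V(G)}\frac{(M)_{uu}}{x_u^2}.$$
   Context: Graphs are finite, simple, undirected, with nonempty vertex set $V(G)$. $d(i,j)$ denotes the distance between vertices $i$ and $j$ in $G$ (with $d(i,j)=\infty$ if they lie in different components). A $k$-independent set of $G$ is a subset $U\subseteq V(G)$ with $d(i,j)>k$ for any two distinct $i,j\in U$; $\alpha_k(G)$ is the maximum size of a $k$-independent set. A $k$-distance coloring of $G$ is a partition $V(G)=V_1\cup\cdots\cup V_t$ in which every $V_i$ is a $k$-independent set. For an $n$-vertex graph $G$, $\mathcal{M}_k(G)$ is the set of pairs $(M,x)$ such that: (a) $M$ is a (symmetric) positive semidefinite real $n\times n$ matrix indexed by the vertices of $G$ with $(M)_{ij}=0$ whenever $d(i,j)>k$; (b) $x=(x_1,\ldots,x_n)^\top\in\mathbb{R}^n$ lies in the range $R(M)=\{My: y\in\mathbb{R}^n\}$ and $x_i\neq 0$ for all $i$. The group inverse $M^\#$ of a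 real square matrix $M$ is the matrix $X$ (unique if it exists) with $MXM=M$, $XMX=X$, $MX=XM$. It exists for positive semidefinite $M$: if $M=U\,\mathrm{diag}(\lambda_1,\ldots,\lambda_n)U^\top$ with $U$ orthogonal, then $M^\#=U\,\mathrm{diag}(\lambda_1^+,\ldots,\lambda_n^+)U^\top$, where $\lambda_i^+=\lambda_i^{ -1}$ if $\lambda_i>0$ and $\lambda_i^+=0$ if $\lambda_i=0$. -}

module Defs where

open import Algebra.Bundles using (RawMonoid)
import Algebra.Definitions.RawMonoid as RawMonoidDefs
open import Data.Bool using (if_then_else_)
open import Data.Fin as Fin using (Fin)
import Data.Fin.Properties as Fin
open import Data.Fin.Subset using (Subset; inside; outside; _∈_; ∣_∣)
open import Data.Fin.Subset.Properties using (_∈?_)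
open import Data.Integer using (+_)
open import Data.List using (List; []; _∷_; _++_; map; filter; head; upTo)
open import Data.List.Extrema.Nat using (max)
open import Data.Nat as ℕ using (ℕ; zero; suc; NonZero)
import Data.Nat.Induction as ℕ
import Data.Nat.Properties as ℕ
open import Data.Product using (∃; ∃!; _×_; _,_; proj₁; proj₂)
open import Data.Rational as ℚ using (ℚ; 0ℚ; 1ℚ; ½)
import Data.Rational.Properties as ℚ
open import Data.Rational.Solver using (module +-*-Solver)
open import Data.Sum using (inj₁; inj₂; [_,_]′)
import Data.Vec as Vec
import Data.Vec.Functional as Vector
open import Data.Vec.Functional using (Vector)
open import Induction.WellFounded using (Acc; acc)
open import Level using (0ℓ)
open import Relation.Binary using (Rel; Decidable; Symmetric)
open import Relation.Binary.Construct.Add.Supremum.Strict ℕ._<_ using (_<⁺_; <⁺-dec)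
open import Relation.Binary.PropositionalEquality
open import Relation.Nullary using (¬_; Dec; yes; no; contradiction; map′)
open import Relation.Nullary.Decidable using (_×-dec_; _→-dec_; ¬?)
open import Relation.Nullary.Construct.Add.Supremum using (_⁺; [_]; ⊤⁺)

flip- : ∀ p q → ℚ.- (p ℚ.- q) ≡ q ℚ.- p
flip- = solve 2 (λ p q → :- (p :- q) := q :- p) refl
  where open +-*-Solver

∣p-q∣<ε : ∀ p q ε → p ℚ.- q ℚ.< ε → q ℚ.- p ℚ.< ε → ℚ.∣ p ℚ.- q ∣ ℚ.< ε
∣p-q∣<ε p q ε h₁ h₂ =
  [ (λ e → subst (ℚ._< ε) (sym e) h₁)
  , (λ e → subst (ℚ._< ε) (sym (trans e (flip- p q))) h₂)
  ]′ (ℚ.∣p∣≡p∨∣p∣≡-p (p ℚ.- q))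

p≤∣p∣ : ∀ p → p ℚ.≤ ℚ.∣ p ∣
p≤∣p∣ p =
  [ (λ 0≤p → ℚ.≤-reflexive (sym (ℚ.0≤p⇒∣p∣≡p 0≤p)))
  , (λ p≤0 → ℚ.≤-trans p≤0 (ℚ.0≤∣p∣ p))
  ]′ (ℚ.≤-total 0ℚ p)

*-pos : ∀ {p q} → 0ℚ ℚ.< p → 0ℚ ℚ.< q → 0ℚ ℚ.< p ℚ.* q
*-pos {p} {q} 0<p 0<q =
  subst (ℚ._< p ℚ.* q) (ℚ.*-zeroʳ p) (ℚ.*-monoʳ-<-pos p {{ℚ.positive 0<p}} 0<q)

0<½ : 0ℚ ℚ.< ½
0<½ = ℚ.positive⁻¹ ½

½ε+½ε : ∀ ε → ½ ℚ.* ε ℚ.+ ½ ℚ.* ε ≡ ε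
½ε+½ε ε = trans (sym (ℚ.*-distribʳ-+ ε ½ ½)) (ℚ.*-identityˡ ε)

*-mono-≤-nonNeg : ∀ p q r s → 0ℚ ℚ.≤ p → 0ℚ ℚ.≤ s →
                  p ℚ.≤ q → r ℚ.≤ s → p ℚ.* r ℚ.≤ q ℚ.* s
*-mono-≤-nonNeg p q r s 0≤p 0≤s p≤q r≤s = ℚ.≤-trans
  (ℚ.*-monoˡ-≤-nonNeg p {{ℚ.nonNegative 0≤p}} r≤s)
  (ℚ.*-monoʳ-≤-nonNeg s {{ℚ.nonNegative 0≤s}} p≤q)

-- Reciprocal extended by 0 ↦ 0.
recip : ℚ → ℚ
recip q with q ℚ.≟ 0ℚ
... | yes _   = 0ℚ
... | no  q≢0 = ℚ.1/_ q {{ℚ.≢-nonZero q≢0}}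

recip-inverseʳ : ∀ q → q ≢ 0ℚ → q ℚ.* recip q ≡ 1ℚ
recip-inverseʳ q q≢0 with q ℚ.≟ 0ℚ
... | yes q≡0 = contradiction q≡0 q≢0
... | no  q≢0′ = ℚ.*-inverseʳ q {{ℚ.≢-nonZero q≢0′}}

pos⇒≢0 : ∀ {q} → 0ℚ ℚ.< q → q ≢ 0ℚ
pos⇒≢0 0<q q≡0 = ℚ.<-irrefl (sym q≡0) 0<q

recip-pos : ∀ {q} → 0ℚ ℚ.< q → 0ℚ ℚ.< recip q
recip-pos {q} 0<q with q ℚ.≟ 0ℚ
... | yes q≡0 = contradiction q≡0 (pos⇒≢0 0<q)
... | no  q≢0 = ℚ.positive⁻¹ _ {{ℚ.1/pos⇒pos q {{ℚ.positive 0<q}}}}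

bounded-away⇒≢0 : ∀ {ε q} → 0ℚ ℚ.< ε → ε ℚ.≤ ℚ.∣ q ∣ → q ≢ 0ℚ
bounded-away⇒≢0 0<ε ε≤∣q∣ refl = ℚ.<-irrefl refl (ℚ.<-≤-trans 0<ε ε≤∣q∣)

∣recip∣≤ : ∀ ε q → 0ℚ ℚ.< ε → ε ℚ.≤ ℚ.∣ q ∣ → ℚ.∣ recip q ∣ ℚ.≤ recip ε
∣recip∣≤ ε q 0<ε ε≤∣q∣ = begin
  r                      ≡⟨ sym (ℚ.*-identityʳ r) ⟩
  r ℚ.* 1ℚ               ≡⟨ cong (r ℚ.*_) (sym (recip-inverseʳ ε (pos⇒≢0 0<ε))) ⟩
  r ℚ.* (ε ℚ.* recip ε)  ≤⟨ ℚ.*-monoˡ-≤-nonNeg r {{ℚ.nonNegative (ℚ.0≤∣p∣ (recip q))}}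
                              (ℚ.*-monoʳ-≤-nonNeg (recip ε)
                                {{ℚ.nonNegative (ℚ.<⇒≤ (recip-pos 0<ε))}} ε≤∣q∣) ⟩
  r ℚ.* (ℚ.∣ q ∣ ℚ.* recip ε) ≡⟨ sym (ℚ.*-assoc r _ _) ⟩
  r ℚ.* ℚ.∣ q ∣ ℚ.* recip ε   ≡⟨ cong (ℚ._* recip ε) r∣q∣≡1 ⟩
  1ℚ ℚ.* recip ε              ≡⟨ ℚ.*-identityˡ _ ⟩
  recip ε                     ∎
  where
  open ℚ.≤-Reasoning
  r = ℚ.∣ recip q ∣
  r∣q∣≡1 : r ℚ.* ℚ.∣ q ∣ ≡ 1ℚ
  r∣q∣≡1 = trans (sym (ℚ.∣p*q∣≡∣p∣*∣q∣ (recip q) q))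
    (cong ℚ.∣_∣ (trans (ℚ.*-comm (recip q) q)
                       (recip-inverseʳ q (bounded-away⇒≢0 0<ε ε≤∣q∣))))

infix 4 _close_

_close_ : ℚ → ℚ → ℚ → Set
(p close q) ε = ℚ.∣ p ℚ.- q ∣ ℚ.< ε

Cauchy : (ℕ → ℚ) → Set
Cauchy s = ∀ ε → 0ℚ ℚ.< ε → ∃ λ N → ∀ m n → N ℕ.≤ m → N ℕ.≤ n → (s m close s n) ε

-- Real numbers are taken up to _≈_ below.
record ℝ : Set where
  constructor _,_
  field
    seq    : ℕ → ℚ
    cauchy : Cauchy seq
open ℝ public

Eventually : (ℕ → Set) → Set
Eventually P = ∃ λ N → ∀ n → N ℕ.≤ n → P n

infix 4 _≈_ _≤_

_≈_ : Rel ℝ 0ℓ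
x ≈ y = ∀ ε → 0ℚ ℚ.< ε → Eventually λ n → ℚ.∣ seq x n ℚ.- seq y n ∣ ℚ.< ε

_≤_ : Rel ℝ 0ℓ
x ≤ y = ∀ ε → 0ℚ ℚ.< ε → Eventually λ n → seq x n ℚ.< seq y n ℚ.+ ε

-- x ≠ 0, read as |x| > 0.  Classically this is ¬ (x ≈ 0); it is the form of
-- x ≠ 0 under which x has an inverse.
infix 4 _≠0
_≠0 : ℝ → Set
x ≠0 = ∃ λ ε → 0ℚ ℚ.< ε × Eventually λ n → ε ℚ.≤ ℚ.∣ seq x n ∣

fromℚ : ℚ → ℝ
fromℚ q = (λ _ → q) , λ ε 0<ε →
  0 , λ _ _ _ _ → subst (λ p → ℚ.∣ p ∣ ℚ.< ε) (sym (ℚ.+-inverseʳ q)) 0<ε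

fromℕ : ℕ → ℝ
fromℕ n = fromℚ (+ n ℚ./ 1)

0ℝ : ℝ
0ℝ = fromℚ 0ℚ

close-sym : ∀ p q ε → (p close q) ε → (q close p) ε
close-sym p q ε h = subst (ℚ._< ε) (trans (sym (ℚ.∣-p∣≡∣p∣ (p ℚ.- q))) (cong ℚ.∣_∣ (flip- p q))) h

join : ∀ N₁ {N₂ n} → N₁ ℕ.⊔ N₂ ℕ.≤ n → N₁ ℕ.≤ n × N₂ ℕ.≤ n
join N₁ h = ℕ.m⊔n≤o⇒m≤o N₁ _ h , ℕ.m⊔n≤o⇒n≤o N₁ _ h

+-close : ∀ p q r s ε → (p close r) (½ ℚ.* ε) → (q close s) (½ ℚ.* ε) →
          (p ℚ.+ q close r ℚ.+ s) ε
+-close p q r s ε h₁ h₂ = begin-strict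
  ℚ.∣ (p ℚ.+ q) ℚ.- (r ℚ.+ s) ∣       ≡⟨ cong ℚ.∣_∣ (regroup p q r s) ⟩
  ℚ.∣ (p ℚ.- r) ℚ.+ (q ℚ.- s) ∣       ≤⟨ ℚ.∣p+q∣≤∣p∣+∣q∣ (p ℚ.- r) (q ℚ.- s) ⟩
  ℚ.∣ p ℚ.- r ∣ ℚ.+ ℚ.∣ q ℚ.- s ∣     <⟨ ℚ.+-mono-< h₁ h₂ ⟩
  ½ ℚ.* ε ℚ.+ ½ ℚ.* ε                 ≡⟨ ½ε+½ε ε ⟩
  ε                                   ∎
  where
  open ℚ.≤-Reasoning
  open +-*-Solver
  regroup : ∀ a b c d → (a ℚ.+ b) ℚ.- (c ℚ.+ d) ≡ (a ℚ.- c) ℚ.+ (b ℚ.- d)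
  regroup = solve 4 (λ a b c d → (a :+ b) :- (c :+ d) := (a :- c) :+ (b :- d)) refl

-- The Cauchy proofs are opaque so that normalising a real expression does not
-- unfold them.
opaque
  +-cauchy : ∀ s t → Cauchy s → Cauchy t → Cauchy (λ n → s n ℚ.+ t n)
  +-cauchy s t cs ct ε 0<ε =
    let N₁ , h₁ = cs (½ ℚ.* ε) (*-pos 0<½ 0<ε)
        N₂ , h₂ = ct (½ ℚ.* ε) (*-pos 0<½ 0<ε)
    in N₁ ℕ.⊔ N₂ , λ m n N≤m N≤n →
      let N₁≤m , N₂≤m = join N₁ N≤m
          N₁≤n , N₂≤n = join N₁ N≤n
      in +-close (s m) (t m) (s n) (t n) ε (h₁ m n N₁≤m N₁≤n) (h₂ m n N₂≤m N₂≤n)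

∣p∣≤∣q∣+1 : ∀ p q → (p close q) 1ℚ → ℚ.∣ p ∣ ℚ.≤ ℚ.∣ q ∣ ℚ.+ 1ℚ
∣p∣≤∣q∣+1 p q h = begin
  ℚ.∣ p ∣                       ≡⟨ cong ℚ.∣_∣ (split p q) ⟩
  ℚ.∣ q ℚ.+ (p ℚ.- q) ∣         ≤⟨ ℚ.∣p+q∣≤∣p∣+∣q∣ q (p ℚ.- q) ⟩
  ℚ.∣ q ∣ ℚ.+ ℚ.∣ p ℚ.- q ∣     ≤⟨ ℚ.+-monoʳ-≤ ℚ.∣ q ∣ (ℚ.<⇒≤ h) ⟩
  ℚ.∣ q ∣ ℚ.+ 1ℚ                ∎
  where
  open ℚ.≤-Reasoning
  open +-*-Solver
  split : ∀ a b → a ≡ b ℚ.+ (a ℚ.- b)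
  split = solve 2 (λ a b → a := b :+ (a :- b)) refl

bound : ∀ s → Cauchy s → ∃ λ B → 0ℚ ℚ.< B × Eventually λ n → ℚ.∣ s n ∣ ℚ.≤ B
bound s cs =
  let N , h = cs 1ℚ (ℚ.positive⁻¹ 1ℚ)
  in ℚ.∣ s N ∣ ℚ.+ 1ℚ ,
     ℚ.+-mono-≤-< (ℚ.0≤∣p∣ (s N)) (ℚ.positive⁻¹ 1ℚ) ,
     N , λ n N≤n → ∣p∣≤∣q∣+1 (s n) (s N) (h n N N≤n ℕ.≤-refl)

small-* : ∀ B δ p q → 0ℚ ℚ.< B → ℚ.∣ p ∣ ℚ.≤ B →
          ℚ.∣ q ∣ ℚ.< recip B ℚ.* δ → ℚ.∣ p ℚ.* q ∣ ℚ.< δ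
small-* B δ p q 0<B p≤B q<δ/B = begin-strict
  ℚ.∣ p ℚ.* q ∣         ≡⟨ ℚ.∣p*q∣≡∣p∣*∣q∣ p q ⟩
  ℚ.∣ p ∣ ℚ.* ℚ.∣ q ∣   ≤⟨ ℚ.*-monoʳ-≤-nonNeg ℚ.∣ q ∣ {{ℚ.nonNegative (ℚ.0≤∣p∣ q)}} p≤B ⟩
  B ℚ.* ℚ.∣ q ∣         <⟨ ℚ.*-monoʳ-<-pos B {{ℚ.positive 0<B}} q<δ/B ⟩
  B ℚ.* (recip B ℚ.* δ) ≡⟨ sym (ℚ.*-assoc B (recip B) δ) ⟩
  B ℚ.* recip B ℚ.* δ   ≡⟨ cong (ℚ._* δ) (recip-inverseʳ B (pos⇒≢0 0<B)) ⟩
  1ℚ ℚ.* δ              ≡⟨ ℚ.*-identityˡ δ ⟩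
  δ                     ∎
  where open ℚ.≤-Reasoning

*-close : ∀ B C p q r s ε → 0ℚ ℚ.< B → 0ℚ ℚ.< C → ℚ.∣ p ∣ ℚ.≤ B → ℚ.∣ s ∣ ℚ.≤ C →
          (q close s) (recip B ℚ.* (½ ℚ.* ε)) → (p close r) (recip C ℚ.* (½ ℚ.* ε)) →
          (p ℚ.* q close r ℚ.* s) ε
*-close B C p q r s ε 0<B 0<C p≤B s≤C h₁ h₂ = begin-strict
  ℚ.∣ p ℚ.* q ℚ.- r ℚ.* s ∣
    ≡⟨ cong ℚ.∣_∣ (regroup p q r s) ⟩
  ℚ.∣ p ℚ.* (q ℚ.- s) ℚ.+ s ℚ.* (p ℚ.- r) ∣
    ≤⟨ ℚ.∣p+q∣≤∣p∣+∣q∣ (p ℚ.* (q ℚ.- s)) (s ℚ.* (p ℚ.- r)) ⟩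
  ℚ.∣ p ℚ.* (q ℚ.- s) ∣ ℚ.+ ℚ.∣ s ℚ.* (p ℚ.- r) ∣
    <⟨ ℚ.+-mono-< (small-* B (½ ℚ.* ε) p (q ℚ.- s) 0<B p≤B h₁)
                  (small-* C (½ ℚ.* ε) s (p ℚ.- r) 0<C s≤C h₂) ⟩
  ½ ℚ.* ε ℚ.+ ½ ℚ.* ε
    ≡⟨ ½ε+½ε ε ⟩
  ε ∎
  where
  open ℚ.≤-Reasoning
  open +-*-Solver
  regroup : ∀ a b c d →
            a ℚ.* b ℚ.- c ℚ.* d ≡ a ℚ.* (b ℚ.- d) ℚ.+ d ℚ.* (a ℚ.- c)
  regroup = solve 4 (λ a b c d → a :* b :- c :* d := a :* (b :- d) :+ d :* (a :- c)) refl

opaque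
  *-cauchy : ∀ s t → Cauchy s → Cauchy t → Cauchy (λ n → s n ℚ.* t n)
  *-cauchy s t cs ct ε 0<ε =
    let B , 0<B , N₁ , s≤B = bound s cs
        C , 0<C , N₂ , t≤C = bound t ct
        N₃ , h₃ = ct (recip B ℚ.* (½ ℚ.* ε)) (*-pos (recip-pos 0<B) (*-pos 0<½ 0<ε))
        N₄ , h₄ = cs (recip C ℚ.* (½ ℚ.* ε)) (*-pos (recip-pos 0<C) (*-pos 0<½ 0<ε))
    in (N₁ ℕ.⊔ N₂) ℕ.⊔ (N₃ ℕ.⊔ N₄) , λ m n N≤m N≤n →
      let N₁₂≤m , N₃₄≤m = join (N₁ ℕ.⊔ N₂) N≤m
          N₁₂≤n , N₃₄≤n = join (N₁ ℕ.⊔ N₂) N≤n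
          N₁≤m , _ = join N₁ N₁₂≤m
          _ , N₂≤n = join N₁ N₁₂≤n
          N₃≤m , N₄≤m = join N₃ N₃₄≤m
          N₃≤n , N₄≤n = join N₃ N₃₄≤n
      in *-close B C (s m) (t m) (s n) (t n) ε 0<B 0<C (s≤B m N₁≤m) (t≤C n N₂≤n)
           (h₃ m n N₃≤m N₃≤n) (h₄ m n N₄≤m N₄≤n)

minus-upper : ∀ p r m ε → r ℚ.≤ m → (p close r) ε → p ℚ.- m ℚ.< ε
minus-upper p r m ε r≤m h = ℚ.≤-<-trans {p ℚ.- m} {p ℚ.- r} {ε}
  (ℚ.+-monoʳ-≤ p {ℚ.- m} {ℚ.- r} (ℚ.neg-antimono-≤ {r} {m} r≤m))
  (ℚ.≤-<-trans {p ℚ.- r} {ℚ.∣ p ℚ.- r ∣} {ε} (p≤∣p∣ (p ℚ.- r)) h)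

⊔-minus : ∀ p q m ε → p ℚ.- m ℚ.< ε → q ℚ.- m ℚ.< ε → (p ℚ.⊔ q) ℚ.- m ℚ.< ε
⊔-minus p q m ε h₁ h₂ =
  [ (λ e → subst (λ z → z ℚ.- m ℚ.< ε) (sym e) h₁)
  , (λ e → subst (λ z → z ℚ.- m ℚ.< ε) (sym e) h₂)
  ]′ (ℚ.⊔-sel p q)

⊔-close : ∀ p q r s ε → (p close r) ε → (q close s) ε → (p ℚ.⊔ q close r ℚ.⊔ s) ε
⊔-close p q r s ε h₁ h₂ = ∣p-q∣<ε (p ℚ.⊔ q) (r ℚ.⊔ s) ε
  (⊔-minus p q (r ℚ.⊔ s) ε
    (minus-upper p r (r ℚ.⊔ s) ε (ℚ.p≤p⊔q r s) h₁)
    (minus-upper q s (r ℚ.⊔ s) ε (ℚ.p≤q⊔p r s) h₂))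
  (⊔-minus r s (p ℚ.⊔ q) ε
    (minus-upper r p (p ℚ.⊔ q) ε (ℚ.p≤p⊔q p q) (close-sym p r ε h₁))
    (minus-upper s q (p ℚ.⊔ q) ε (ℚ.p≤q⊔p p q) (close-sym q s ε h₂)))

opaque
  ⊔-cauchy : ∀ s t → Cauchy s → Cauchy t → Cauchy (λ n → s n ℚ.⊔ t n)
  ⊔-cauchy s t cs ct ε 0<ε =
    let N₁ , h₁ = cs ε 0<ε
        N₂ , h₂ = ct ε 0<ε
    in N₁ ℕ.⊔ N₂ , λ m n N≤m N≤n →
      let N₁≤m , N₂≤m = join N₁ N≤m
          N₁≤n , N₂≤n = join N₁ N≤n
      in ⊔-close (s m) (t m) (s n) (t n) ε (h₁ m n N₁≤m N₁≤n) (h₂ m n N₂≤m N₂≤n)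

recip-difference : ∀ a b → a ≢ 0ℚ → b ≢ 0ℚ →
                   recip a ℚ.- recip b ≡ recip a ℚ.* recip b ℚ.* (b ℚ.- a)
recip-difference a b a≢0 b≢0 = begin
  r ℚ.- s                           ≡⟨ sym (cong₂ ℚ._-_ (ℚ.*-identityˡ r) (ℚ.*-identityˡ s)) ⟩
  1ℚ ℚ.* r ℚ.- 1ℚ ℚ.* s             ≡⟨ sym (cong₂ (λ y z → y ℚ.* r ℚ.- z ℚ.* s)
                                         (recip-inverseʳ b b≢0) (recip-inverseʳ a a≢0)) ⟩
  (b ℚ.* s) ℚ.* r ℚ.- (a ℚ.* r) ℚ.* s ≡⟨ expand a b r s ⟩
  r ℚ.* s ℚ.* (b ℚ.- a)             ∎
  where
  open ≡-Reasoning
  open +-*-Solver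
  r = recip a
  s = recip b
  expand : ∀ a b r s → (b ℚ.* s) ℚ.* r ℚ.- (a ℚ.* r) ℚ.* s ≡ r ℚ.* s ℚ.* (b ℚ.- a)
  expand = solve 4 (λ a b r s → (b :* s) :* r :- (a :* r) :* s := r :* s :* (b :- a)) refl

recip-close : ∀ δ a b ε → 0ℚ ℚ.< δ → δ ℚ.≤ ℚ.∣ a ∣ → δ ℚ.≤ ℚ.∣ b ∣ →
              (b close a) (δ ℚ.* δ ℚ.* ε) → (recip a close recip b) ε
recip-close δ a b ε 0<δ δ≤∣a∣ δ≤∣b∣ h = begin-strict
  ℚ.∣ recip a ℚ.- recip b ∣
    ≡⟨ cong ℚ.∣_∣ (recip-difference a b (bounded-away⇒≢0 0<δ δ≤∣a∣) (bounded-away⇒≢0 0<δ δ≤∣b∣)) ⟩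
  ℚ.∣ recip a ℚ.* recip b ℚ.* (b ℚ.- a) ∣
    ≡⟨ ℚ.∣p*q∣≡∣p∣*∣q∣ (recip a ℚ.* recip b) (b ℚ.- a) ⟩
  ℚ.∣ recip a ℚ.* recip b ∣ ℚ.* ℚ.∣ b ℚ.- a ∣
    ≡⟨ cong (ℚ._* ℚ.∣ b ℚ.- a ∣) (ℚ.∣p*q∣≡∣p∣*∣q∣ (recip a) (recip b)) ⟩
  ℚ.∣ recip a ∣ ℚ.* ℚ.∣ recip b ∣ ℚ.* ℚ.∣ b ℚ.- a ∣
    ≤⟨ ℚ.*-monoʳ-≤-nonNeg ℚ.∣ b ℚ.- a ∣ {{ℚ.nonNegative (ℚ.0≤∣p∣ (b ℚ.- a))}}
         (*-mono-≤-nonNeg ℚ.∣ recip a ∣ d ℚ.∣ recip b ∣ d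
           (ℚ.0≤∣p∣ (recip a)) (ℚ.<⇒≤ 0<d)
           (∣recip∣≤ δ a 0<δ δ≤∣a∣) (∣recip∣≤ δ b 0<δ δ≤∣b∣)) ⟩
  d ℚ.* d ℚ.* ℚ.∣ b ℚ.- a ∣
    <⟨ ℚ.*-monoʳ-<-pos (d ℚ.* d) {{ℚ.positive (*-pos 0<d 0<d)}} h ⟩
  d ℚ.* d ℚ.* (δ ℚ.* δ ℚ.* ε)
    ≡⟨ shuffle d δ ε ⟩
  (δ ℚ.* d) ℚ.* (δ ℚ.* d) ℚ.* ε
    ≡⟨ cong (λ z → z ℚ.* z ℚ.* ε) (recip-inverseʳ δ (pos⇒≢0 0<δ)) ⟩
  1ℚ ℚ.* ε
    ≡⟨ ℚ.*-identityˡ ε ⟩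
  ε ∎
  where
  open ℚ.≤-Reasoning
  open +-*-Solver
  d = recip δ
  0<d = recip-pos 0<δ
  shuffle : ∀ d δ ε → d ℚ.* d ℚ.* (δ ℚ.* δ ℚ.* ε) ≡ (δ ℚ.* d) ℚ.* (δ ℚ.* d) ℚ.* ε
  shuffle = solve 3 (λ d δ ε → d :* d :* (δ :* δ :* ε) := (δ :* d) :* (δ :* d) :* ε) refl

opaque
  recip-cauchy : ∀ s → Cauchy s → ∀ δ → 0ℚ ℚ.< δ →
                 Eventually (λ n → δ ℚ.≤ ℚ.∣ s n ∣) → Cauchy (λ n → recip (s n))
  recip-cauchy s cs δ 0<δ (N₁ , δ≤∣s∣) ε 0<ε =
    let N₂ , h₂ = cs (δ ℚ.* δ ℚ.* ε) (*-pos (*-pos 0<δ 0<δ) 0<ε)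
    in N₁ ℕ.⊔ N₂ , λ m n N≤m N≤n →
      let N₁≤m , N₂≤m = join N₁ N≤m
          N₁≤n , N₂≤n = join N₁ N≤n
      in recip-close δ (s m) (s n) ε 0<δ (δ≤∣s∣ m N₁≤m) (δ≤∣s∣ n N₁≤n) (h₂ n m N₂≤n N₂≤m)

infixl 6 _+_ _⊔_
infixl 7 _*_

_+_ _*_ _⊔_ : ℝ → ℝ → ℝ
(s , cs) + (t , ct) = (λ n → s n ℚ.+ t n) , +-cauchy s t cs ct
(s , cs) * (t , ct) = (λ n → s n ℚ.* t n) , *-cauchy s t cs ct
(s , cs) ⊔ (t , ct) = (λ n → s n ℚ.⊔ t n) , ⊔-cauchy s t cs ct

inverse : (x : ℝ) → x ≠0 → ℝ
inverse (s , cs) (δ , 0<δ , away) = (λ n → recip (s n)) , recip-cauchy s cs δ 0<δ away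

divide : (x y : ℝ) → y ≠0 → ℝ
divide x y y≠0 = x * inverse y y≠0

*-≠0 : ∀ x y → x ≠0 → y ≠0 → x * y ≠0
*-≠0 (s , _) (t , _) (δ , 0<δ , N₁ , h₁) (ε , 0<ε , N₂ , h₂) =
  δ ℚ.* ε , *-pos 0<δ 0<ε , N₁ ℕ.⊔ N₂ , λ n N≤n →
    let N₁≤n , N₂≤n = join N₁ N≤n in
    subst (δ ℚ.* ε ℚ.≤_) (sym (ℚ.∣p*q∣≡∣p∣*∣q∣ (s n) (t n)))
      (*-mono-≤-nonNeg δ ℚ.∣ s n ∣ ε ℚ.∣ t n ∣
        (ℚ.<⇒≤ 0<δ) (ℚ.0≤∣p∣ (t n)) (h₁ n N₁≤n) (h₂ n N₂≤n))

+-rawMonoid : RawMonoid 0ℓ 0ℓ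
+-rawMonoid = record { Carrier = ℝ ; _≈_ = _≈_ ; _∙_ = _+_ ; ε = 0ℝ }

open RawMonoidDefs +-rawMonoid public using (sum)

sumOver : ∀ {n} → Subset n → Vector ℝ n → ℝ
sumOver S f = sum λ u → if Vec.lookup S u then f u else 0ℝ

maximum : ∀ {n} .{{_ : NonZero n}} → Vector ℝ n → ℝ
maximum {suc n} v = Vector.foldr _⊔_ (Vector.head v) (Vector.tail v)

Matrix : ℕ → Set
Matrix n = Vector (Vector ℝ n) n

infix  4 _≋_
infixl 7 _·_ _*ᵥ_ _*ₘ_

_≋_ : ∀ {n} → Rel (Matrix n) 0ℓ
M ≋ N = ∀ i j → M i j ≈ N i j

_·_ : ∀ {n} → Vector ℝ n → Vector ℝ n → ℝ
x · y = sum λ i → x i * y i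

_*ᵥ_ : ∀ {n} → Matrix n → Vector ℝ n → Vector ℝ n
(M *ᵥ x) i = M i · x

_*ₘ_ : ∀ {n} → Matrix n → Matrix n → Matrix n
(M *ₘ N) i j = M i · λ l → N l j

record PositiveSemidefinite {n} (M : Matrix n) : Set where
  field
    symmetric : ∀ i j → M i j ≈ M j i
    nonneg    : ∀ y → 0ℝ ≤ y · (M *ᵥ y)

_∈Range_ : ∀ {n} → Vector ℝ n → Matrix n → Set
x ∈Range M = ∃ λ y → ∀ i → x i ≈ (M *ᵥ y) i

-- A relation rather than a function of M: without deciding the rank of M, its
-- group inverse cannot be computed from M.
record IsGroupInverse {n} (M X : Matrix n) : Set where
  field
    MXM≋M : M *ₘ X *ₘ M ≋ M
    XMX≋X : X *ₘ M *ₘ X ≋ X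
    MX≋XM : M *ₘ X ≋ X *ₘ M

record Graph (n : ℕ) : Set₁ where
  field
    Adj        : Rel (Fin n) 0ℓ
    adj?       : Decidable Adj
    adj-sym    : Symmetric Adj
    adj-irrefl : ∀ {i} → ¬ Adj i i

module _ {n : ℕ} (G : Graph n) where
  open Graph G

  data Walk : ℕ → Rel (Fin n) 0ℓ where
    []  : ∀ {i} → Walk 0 i i
    _∷_ : ∀ {ℓ i j k} → Adj i j → Walk ℓ j k → Walk (suc ℓ) i k

  walk? : ∀ ℓ → Decidable (Walk ℓ)
  walk? zero    i j = map′ (λ { refl → [] }) (λ { [] → refl }) (i Fin.≟ j)
  walk? (suc ℓ) i j = map′ (λ (_ , a , w) → a ∷ w) (λ { (a ∷ w) → _ , a , w })
    (Fin.any? λ l → adj? i l ×-dec walk? ℓ l j)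

  -- The length of a shortest walk, or ⊤⁺ (that is, ∞) if there is none.
  -- Lengths below n suffice, by shorten.
  dist : Fin n → Fin n → ℕ ⁺
  dist i j = head (filter (λ ℓ → walk? ℓ i j) (upTo n))

  vertex : ∀ {ℓ i j} → Walk ℓ i j → Fin (suc ℓ) → Fin n
  vertex {i = i} _       Fin.zero    = i
  vertex         (_ ∷ w) (Fin.suc a) = vertex w a

  dropTo : ∀ {ℓ i j} (w : Walk ℓ i j) (a : Fin (suc ℓ)) →
           ∃ λ ℓ′ → ℓ′ ℕ.≤ ℓ × Walk ℓ′ (vertex w a) j
  dropTo w       Fin.zero    = _ , ℕ.≤-refl , w
  dropTo (_ ∷ w) (Fin.suc a) with ℓ′ , le , w′ ← dropTo w a = ℓ′ , ℕ.m≤n⇒m≤1+n le , w′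

  cut : ∀ {ℓ i j} (w : Walk ℓ i j) (a b : Fin (suc ℓ)) → a Fin.< b →
        vertex w a ≡ vertex w b → ∃ λ ℓ′ → ℓ′ ℕ.< ℓ × Walk ℓ′ i j
  cut (_ ∷ w) Fin.zero (Fin.suc b) _ e with ℓ′ , le , w′ ← dropTo w b =
    ℓ′ , ℕ.s≤s le , subst (λ v → Walk ℓ′ v _) (sym e) w′
  cut (e′ ∷ w) (Fin.suc a) (Fin.suc b) (ℕ.s≤s a<b) e
    with ℓ′ , lt , w′ ← cut w a b a<b e = suc ℓ′ , ℕ.s≤s lt , e′ ∷ w′

  shorten′ : ∀ {ℓ i j} → Acc ℕ._<_ ℓ → Walk ℓ i j →
             ∃ λ ℓ′ → ℓ′ ℕ.≤ ℓ × ℓ′ ℕ.< n × Walk ℓ′ i j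
  shorten′ {ℓ} (acc rec) w with ℓ ℕ.<? n
  ... | yes ℓ<n = ℓ , ℕ.≤-refl , ℓ<n , w
  ... | no  ℓ≮n
    with a , b , a<b , e ← Fin.pigeonhole (ℕ.s≤s (ℕ.≮⇒≥ ℓ≮n)) (vertex w)
    with ℓ₁ , lt₁ , w₁ ← cut w a b a<b e
    with ℓ₂ , le₂ , lt₂ , w₂ ← shorten′ (rec lt₁) w₁ =
    ℓ₂ , ℕ.≤-trans le₂ (ℕ.<⇒≤ lt₁) , lt₂ , w₂

  shorten : ∀ {ℓ i j} → Walk ℓ i j → ∃ λ ℓ′ → ℓ′ ℕ.≤ ℓ × ℓ′ ℕ.< n × Walk ℓ′ i j
  shorten = shorten′ (ℕ.<-wellFounded _)

  Independent : ℕ → Subset n → Set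
  Independent k U = ∀ i j → i ∈ U → j ∈ U → i ≢ j → [ k ] <⁺ dist i j

  independent? : ∀ k U → Dec (Independent k U)
  independent? k U = Fin.all? λ i → Fin.all? λ j →
    (i ∈? U) →-dec (j ∈? U) →-dec ¬? (i Fin.≟ j) →-dec <⁺-dec ℕ._<?_ [ k ] (dist i j)

allSubsets : ∀ n → List (Subset n)
allSubsets zero    = Vec.[] ∷ []
allSubsets (suc n) = map (outside Vec.∷_) (allSubsets n) ++ map (inside Vec.∷_) (allSubsets n)

-- The default 0 of max is harmless, as ∅ is independent.
α : ∀ {n} → ℕ → Graph n → ℕ
α {n} k G = max 0 (map ∣_∣ (filter (independent? G k) (allSubsets n)))

-- Parts are allowed to be empty, so partitions into nonempty parts are included.
record IsDistanceColoring {n} (k : ℕ) (G : Graph n) {t} (V : Vector (Subset n) t) : Set where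
  field
    partition   : ∀ u → ∃! _≡_ λ i → u ∈ V i
    independent : ∀ i → Independent G k (V i)

record 𝓜 {n} (k : ℕ) (G : Graph n) (M : Matrix n) (x : Vector ℝ n) : Set where
  field
    psd     : PositiveSemidefinite M
    local   : ∀ i j → [ k ] <⁺ dist G i j → M i j ≈ 0ℝ
    inRange : x ∈Range M
    nonzero : ∀ i → x i ≠0

  -- (M)ᵤᵤ / xᵤ²
  ratio : Vector ℝ n
  ratio u = divide (M u u) (x u * x u) (*-≠0 (x u) (x u) (nonzero u) (nonzero u))

{-# OPTIONS --safe #-}

-- Write x = M y.  Then x · M# x ≈ y · M y, and for an independent set S the
-- vector z that is 1 / xᵤ on S and 0 elsewhere satisfies z · M y = z · x = ∣ S ∣
-- and z · M z = Σ_{u ∈ S} Mᵤᵤ / xᵤ², the off-diagonal terms vanishing by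
-- locality.  The first inequality is therefore Cauchy–Schwarz for the
-- semidefinite form of M; the other two follow from it.
module Submission where

open import Algebra.Bundles using (CommutativeSemiring)
import Algebra.Properties.Semiring.Sum as Sum
open import Data.Bool using (true; false; if_then_else_)
open import Data.Fin as Fin using (Fin)
import Data.Fin.Properties as Fin
open import Data.Fin.Subset using (Subset; _∈_; ⁅_⁆; ⊥; ∣_∣)
open import Data.Fin.Subset.Properties using (∉⊥; ∣⊥∣≡0; x∈⁅y⁆⇒x≡y; ∣⁅x⁆∣≡1)
open import Data.Integer as ℤ using (+_)
import Data.Integer.Properties as ℤ
open import Data.List using (map; filter)
open import Data.List.Extrema.Nat using (argmax-sel)
open import Data.List.Membership.Propositional.Properties using (∈-map⁻; ∈-filter⁻)
open import Data.Nat as ℕ using (ℕ; zero; suc; NonZero; _^_)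
import Data.Nat.Properties as ℕ
open import Data.Product using (∃; _×_; _,_; proj₁; proj₂)
open import Data.Rational as ℚ using (ℚ; 0ℚ; 1ℚ; ½)
import Data.Rational.Properties as ℚ
open import Data.Rational.Solver using (module +-*-Solver)
import Data.Rational.Unnormalised as ℚᵘ
import Data.Rational.Unnormalised.Properties as ℚᵘ
open import Data.Sum using (inj₁; inj₂; [_,_]′)
open import Data.Vec as Vec using ([]; _∷_)
open import Data.Vec.Functional using (Vector; foldr; removeAt; replicate)
open import Data.Vec.Properties using (lookup⇒[]=; []=⇒lookup)
open import Function using (id; const; _∘_)
open import Level using (0ℓ)
open import Relation.Binary using (IsEquivalence; Preorder)
open import Relation.Binary.PropositionalEquality as ≡ using (_≡_; _≢_; _≗_; refl)
import Relation.Binary.Reasoning.Preorder as PreorderReasoning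
import Relation.Binary.Reasoning.Setoid as SetoidReasoning
open import Relation.Nullary using (contradiction)
open import Defs

open +-*-Solver using (solve; con; _:+_; _:*_; _:-_; :-_; _:=_)

-- Ordered semiring structure on ℝ

-- _≈_ and _≤_ unfold to statements from which the two reals cannot be inferred;
-- the wrappers keep them inferable.
infix 4 _≃_ _≼_

record _≃_ (x y : ℝ) : Set where
  constructor equal
  field unwrap : x ≈ y

record _≼_ (x y : ℝ) : Set where
  constructor less
  field unwrap : x ≤ y

½ε>0 : ∀ {ε} → 0ℚ ℚ.< ε → 0ℚ ℚ.< ½ ℚ.* ε
½ε>0 = *-pos 0<½

+-halves : ∀ p ε → p ℚ.+ ½ ℚ.* ε ℚ.+ ½ ℚ.* ε ≡ p ℚ.+ ε
+-halves p ε = ≡.trans (ℚ.+-assoc p _ _) (≡.cong (p ℚ.+_) (½ε+½ε ε))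

-- The operations on `ℝ` act termwise, so this lifts every identity of `ℚ`, in particular those
-- found by the ring solver, to an equation of reals.
≗⇒≃ : ∀ {x y} → seq x ≗ seq y → x ≃ y
≗⇒≃ {x} {y} x≗y = equal λ ε 0<ε → 0 , λ n _ →
  ≡.subst (ℚ._< ε) (≡.sym (≡.cong ℚ.∣_∣ (≡.trans (≡.cong (ℚ._- seq y n) (x≗y n)) (ℚ.+-inverseʳ (seq y n))))) 0<ε

≃-sym : ∀ {x y} → x ≃ y → y ≃ x
≃-sym {x} {y} (equal x≈y) = equal λ ε 0<ε → let N , h = x≈y ε 0<ε in
  N , λ n N≤n → close-sym (seq x n) (seq y n) ε (h n N≤n)

≃-trans : ∀ {x y z} → x ≃ y → y ≃ z → x ≃ z
≃-trans {x} {y} {z} (equal x≈y) (equal y≈z) = equal λ ε 0<ε →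
  let N₁ , h₁ = x≈y (½ ℚ.* ε) (½ε>0 0<ε)
      N₂ , h₂ = y≈z (½ ℚ.* ε) (½ε>0 0<ε)
  in N₁ ℕ.⊔ N₂ , λ n N≤n →
    let N₁≤n , N₂≤n = join N₁ N≤n in
    ≡.subst (λ d → ℚ.∣ d ∣ ℚ.< ε) (cancel (seq x n) (seq y n) (seq z n))
      (+-close (seq x n) (seq y n) (seq y n) (seq z n) ε (h₁ n N₁≤n) (h₂ n N₂≤n))
  where
  cancel : ∀ a b c → (a ℚ.+ b) ℚ.- (b ℚ.+ c) ≡ a ℚ.- c
  cancel = solve 3 (λ a b c → (a :+ b) :- (b :+ c) := a :- c) refl

≃-isEquivalence : IsEquivalence _≃_
≃-isEquivalence = record
  { refl  = ≗⇒≃ λ _ → refl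
  ; sym   = ≃-sym
  ; trans = ≃-trans
  }

+-cong : ∀ {x x′ y y′} → x ≃ x′ → y ≃ y′ → x + y ≃ x′ + y′
+-cong {x} {x′} {y} {y′} (equal x≈x′) (equal y≈y′) = equal λ ε 0<ε →
  let N₁ , h₁ = x≈x′ (½ ℚ.* ε) (½ε>0 0<ε)
      N₂ , h₂ = y≈y′ (½ ℚ.* ε) (½ε>0 0<ε)
  in N₁ ℕ.⊔ N₂ , λ n N≤n →
    let N₁≤n , N₂≤n = join N₁ N≤n in
    +-close (seq x n) (seq y n) (seq x′ n) (seq y′ n) ε (h₁ n N₁≤n) (h₂ n N₂≤n)

*-cong : ∀ {x x′ y y′} → x ≃ x′ → y ≃ y′ → x * y ≃ x′ * y′
*-cong {x} {x′} {y} {y′} (equal x≈x′) (equal y≈y′) = equal λ ε 0<ε →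
  -- The difference splits as x y - x′ y′ = x (y - y′) + y′ (x - x′), so `x` and `y′` are the two
  -- factors to bound, and dividing ε/2 by each bound gives the accuracy required of the other
  -- difference.
  let B , 0<B , N₁ , x≤B = bound (seq x) (cauchy x)
      C , 0<C , N₂ , y′≤C = bound (seq y′) (cauchy y′)
      N₃ , h₃ = y≈y′ (recip B ℚ.* (½ ℚ.* ε)) (*-pos (recip-pos 0<B) (½ε>0 0<ε))
      N₄ , h₄ = x≈x′ (recip C ℚ.* (½ ℚ.* ε)) (*-pos (recip-pos 0<C) (½ε>0 0<ε))
  in (N₁ ℕ.⊔ N₂) ℕ.⊔ (N₃ ℕ.⊔ N₄) , λ n N≤n →
    let N₁₂≤n , N₃₄≤n = join (N₁ ℕ.⊔ N₂) N≤n
        N₁≤n , N₂≤n = join N₁ N₁₂≤n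
        N₃≤n , N₄≤n = join N₃ N₃₄≤n
    in *-close B C (seq x n) (seq y n) (seq x′ n) (seq y′ n) ε 0<B 0<C
         (x≤B n N₁≤n) (y′≤C n N₂≤n) (h₃ n N₃≤n) (h₄ n N₄≤n)

1ℝ : ℝ
1ℝ = fromℕ 1

-- This gives access to the generic laws of finite sums. A semiring suffices: negative terms are
-- written as products with `fromℚ (ℚ.- 1ℚ)`.
ℝ-commutativeSemiring : CommutativeSemiring 0ℓ 0ℓ
ℝ-commutativeSemiring = record
  { Carrier = ℝ ; _≈_ = _≃_ ; _+_ = _+_ ; _*_ = _*_ ; 0# = 0ℝ ; 1# = 1ℝ
  ; isCommutativeSemiring = record
    { isSemiring = record
      { isSemiringWithoutAnnihilatingZero = record
        { +-isCommutativeMonoid = record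
          { isMonoid = record
            { isSemigroup = record
              { isMagma = record { isEquivalence = ≃-isEquivalence ; ∙-cong = +-cong }
              ; assoc = λ x y z → ≗⇒≃ λ n → ℚ.+-assoc (seq x n) (seq y n) (seq z n)
              }
            ; identity = (λ x → ≗⇒≃ λ n → ℚ.+-identityˡ (seq x n))
                       , (λ x → ≗⇒≃ λ n → ℚ.+-identityʳ (seq x n))
            }
          ; comm = λ x y → ≗⇒≃ λ n → ℚ.+-comm (seq x n) (seq y n)
          }
        ; *-cong = *-cong
        ; *-assoc = λ x y z → ≗⇒≃ λ n → ℚ.*-assoc (seq x n) (seq y n) (seq z n)
        ; *-identity = (λ x → ≗⇒≃ λ n → ℚ.*-identityˡ (seq x n))
                     , (λ x → ≗⇒≃ λ n → ℚ.*-identityʳ (seq x n))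
        ; distrib = (λ x y z → ≗⇒≃ λ n → ℚ.*-distribˡ-+ (seq x n) (seq y n) (seq z n))
                  , (λ x y z → ≗⇒≃ λ n → ℚ.*-distribʳ-+ (seq x n) (seq y n) (seq z n))
        }
      ; zero = (λ x → ≗⇒≃ λ n → ℚ.*-zeroˡ (seq x n))
             , (λ x → ≗⇒≃ λ n → ℚ.*-zeroʳ (seq x n))
      }
    ; *-comm = λ x y → ≗⇒≃ λ n → ℚ.*-comm (seq x n) (seq y n)
    }
  }

open CommutativeSemiring ℝ-commutativeSemiring
  using (setoid; semiring; +-congˡ; +-congʳ; *-congˡ; *-congʳ; *-assoc; *-comm
        ; +-identityˡ; +-identityʳ; *-identityˡ; *-identityʳ; zeroˡ; zeroʳ; distribˡ; distribʳ)
  renaming (refl to ≃-refl; reflexive to ≃-reflexive)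
open Sum semiring
  using (sum-cong-≋; sum-replicate-zero; sum-remove; ∑-distrib-+; ∑-comm; *-distribˡ-sum; *-distribʳ-sum)

-- The order on ℝ

pointwise⇒≼ : ∀ {x y} → (∀ n → seq x n ℚ.≤ seq y n) → x ≼ y
pointwise⇒≼ {x} {y} x≤y = less λ ε 0<ε → 0 , λ n _ →
  ≡.subst (ℚ._< seq y n ℚ.+ ε) (ℚ.+-identityʳ (seq x n)) (ℚ.+-mono-≤-< (x≤y n) 0<ε)

≃⇒≼ : ∀ {x y} → x ≃ y → x ≼ y
≃⇒≼ {x} {y} (equal x≈y) = less λ ε 0<ε → let N , h = x≈y ε 0<ε in
  N , λ n N≤n → ≡.subst (ℚ._< seq y n ℚ.+ ε) (cancel (seq x n) (seq y n))
    (ℚ.+-monoʳ-< (seq y n) (ℚ.≤-<-trans (p≤∣p∣ (seq x n ℚ.- seq y n)) (h n N≤n)))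
  where
  cancel : ∀ a b → b ℚ.+ (a ℚ.- b) ≡ a
  cancel = solve 2 (λ a b → b :+ (a :- b) := a) refl

≼-trans : ∀ {x y z} → x ≼ y → y ≼ z → x ≼ z
≼-trans {x} {y} {z} (less x≤y) (less y≤z) = less λ ε 0<ε →
  let N₁ , h₁ = x≤y (½ ℚ.* ε) (½ε>0 0<ε)
      N₂ , h₂ = y≤z (½ ℚ.* ε) (½ε>0 0<ε)
  in N₁ ℕ.⊔ N₂ , λ n N≤n →
    let N₁≤n , N₂≤n = join N₁ N≤n in
    ℚ.<-≤-trans (ℚ.<-trans (h₁ n N₁≤n) (ℚ.+-monoˡ-< (½ ℚ.* ε) (h₂ n N₂≤n)))
      (ℚ.≤-reflexive (+-halves (seq z n) ε))

≼-preorder : Preorder 0ℓ 0ℓ 0ℓ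
≼-preorder = record
  { Carrier = ℝ ; _≈_ = _≃_ ; _≲_ = _≼_
  ; isPreorder = record
    { isEquivalence = ≃-isEquivalence
    ; reflexive = ≃⇒≼
    ; trans = ≼-trans
    }
  }

open Preorder ≼-preorder using () renaming (refl to ≼-refl)
module ≼-Reasoning = PreorderReasoning ≼-preorder
module ≃-Reasoning = SetoidReasoning setoid

+-mono-≼ : ∀ {x x′ y y′} → x ≼ x′ → y ≼ y′ → x + y ≼ x′ + y′
+-mono-≼ {x} {x′} {y} {y′} (less x≤x′) (less y≤y′) = less λ ε 0<ε →
  let N₁ , h₁ = x≤x′ (½ ℚ.* ε) (½ε>0 0<ε)
      N₂ , h₂ = y≤y′ (½ ℚ.* ε) (½ε>0 0<ε)
  in N₁ ℕ.⊔ N₂ , λ n N≤n →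
    let N₁≤n , N₂≤n = join N₁ N≤n in
    ℚ.<-≤-trans (ℚ.+-mono-< (h₁ n N₁≤n) (h₂ n N₂≤n))
      (ℚ.≤-reflexive (≡.trans (regroup (seq x′ n) (seq y′ n) (½ ℚ.* ε))
                              (+-halves (seq x′ n ℚ.+ seq y′ n) ε)))
  where
  regroup : ∀ a b h → (a ℚ.+ h) ℚ.+ (b ℚ.+ h) ≡ a ℚ.+ b ℚ.+ h ℚ.+ h
  regroup = solve 3 (λ a b h → (a :+ h) :+ (b :+ h) := a :+ b :+ h :+ h) refl

x≼x+y : ∀ {x y} → 0ℝ ≼ y → x ≼ x + y
x≼x+y {x} {y} 0≼y = begin
  x       ≈⟨ +-identityʳ x ⟨
  x + 0ℝ  ≲⟨ +-mono-≼ ≼-refl 0≼y ⟩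
  x + y   ∎
  where open ≼-Reasoning

square-nonneg : ∀ x → 0ℝ ≼ x * x
square-nonneg x = pointwise⇒≼ λ n → let q = seq x n in
  [ (λ 0≤q → ≡.subst (ℚ._≤ q ℚ.* q) (ℚ.*-zeroʳ q)
      (ℚ.*-monoˡ-≤-nonNeg q {{ℚ.nonNegative 0≤q}} 0≤q))
  , (λ q≤0 → ≡.subst (ℚ._≤ q ℚ.* q) (ℚ.*-zeroʳ q)
      (ℚ.*-monoˡ-≤-nonPos q {{ℚ.nonPositive q≤0}} q≤0))
  ]′ (ℚ.≤-total 0ℚ q)

∣q∣≤B⇒q≤B : ∀ {q B} → ℚ.∣ q ∣ ℚ.≤ B → q ℚ.≤ B
∣q∣≤B⇒q≤B {q} = ℚ.≤-trans (p≤∣p∣ q)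

recip-inverse-* : ∀ {B} δ → 0ℚ ℚ.< B → B ℚ.* (recip B ℚ.* δ) ≡ δ
recip-inverse-* {B} δ 0<B = ≡.trans (≡.sym (ℚ.*-assoc B (recip B) δ))
  (≡.trans (≡.cong (ℚ._* δ) (recip-inverseʳ B (pos⇒≢0 0<B))) (ℚ.*-identityˡ δ))

-- Removes the small positive shifts by which undecidable case distinctions on signs are avoided
-- below. If B eventually bounds the sequence of `z`, the choice δ = ε/(2B) keeps the error term
-- below ε/2, and the other half of ε pays for the slack in the hypothesis.
≼-limit : ∀ {x y} z → (∀ δ → 0ℚ ℚ.< δ → x ≼ y + fromℚ δ * z) → x ≼ y
≼-limit {x} {y} z h = less λ ε 0<ε →
  let B , 0<B , N₁ , z≤B = bound (seq z) (cauchy z)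
      δ = recip B ℚ.* (½ ℚ.* ε)
      0<δ = *-pos (recip-pos 0<B) (½ε>0 0<ε)
      N₂ , h₂ = _≼_.unwrap (h δ 0<δ) (½ ℚ.* ε) (½ε>0 0<ε)
  in N₁ ℕ.⊔ N₂ , λ n N≤n →
    let N₁≤n , N₂≤n = join N₁ N≤n
        open ℚ.≤-Reasoning
    in begin-strict
      seq x n                                     <⟨ h₂ n N₂≤n ⟩
      seq y n ℚ.+ δ ℚ.* seq z n ℚ.+ ½ ℚ.* ε       ≤⟨ ℚ.+-monoˡ-≤ (½ ℚ.* ε) (ℚ.+-monoʳ-≤ (seq y n)
                                                       (ℚ.*-monoˡ-≤-nonNeg δ {{ℚ.nonNegative (ℚ.<⇒≤ 0<δ)}}
                                                         (∣q∣≤B⇒q≤B (z≤B n N₁≤n)))) ⟩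
      seq y n ℚ.+ δ ℚ.* B ℚ.+ ½ ℚ.* ε             ≡⟨ ≡.cong (λ p → seq y n ℚ.+ p ℚ.+ ½ ℚ.* ε)
                                                       (≡.trans (ℚ.*-comm δ B) (recip-inverse-* (½ ℚ.* ε) 0<B)) ⟩
      seq y n ℚ.+ ½ ℚ.* ε ℚ.+ ½ ℚ.* ε             ≡⟨ +-halves (seq y n) ε ⟩
      seq y n ℚ.+ ε                               ∎

-- The constructive form of x > 0: one rational lower bound serves for all late terms, which is what
-- cancelling a factor requires.
Positive : ℝ → Set
Positive x = ∃ λ δ → 0ℚ ℚ.< δ × Eventually λ n → δ ℚ.≤ seq x n

-- Late terms of `x` exceed -δ/2, so half of the shift survives as a lower bound.
nonneg+pos : ∀ {x} δ → 0ℝ ≼ x → 0ℚ ℚ.< δ → Positive (x + fromℚ δ)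
nonneg+pos {x} δ (less 0≤x) 0<δ = let N , h = 0≤x (½ ℚ.* δ) (½ε>0 0<δ) in
  ½ ℚ.* δ , ½ε>0 0<δ , N , λ n N≤n → begin
    ½ ℚ.* δ                             ≡⟨ ℚ.+-identityˡ (½ ℚ.* δ) ⟨
    0ℚ ℚ.+ ½ ℚ.* δ                      ≤⟨ ℚ.+-monoˡ-≤ (½ ℚ.* δ) (ℚ.<⇒≤ (h n N≤n)) ⟩
    seq x n ℚ.+ ½ ℚ.* δ ℚ.+ ½ ℚ.* δ     ≡⟨ +-halves (seq x n) δ ⟩
    seq x n ℚ.+ δ                       ∎
  where open ℚ.≤-Reasoning

*-monoˡ-≼-pos : ∀ {z x y} → Positive z → x ≼ y → z * x ≼ z * y
*-monoˡ-≼-pos {z} {x} {y} (δ , 0<δ , N₁ , δ≤z) (less x≤y) = less λ ε 0<ε →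
  let B , 0<B , N₂ , z≤B = bound (seq z) (cauchy z)
      -- The slack in x ≤ y gets multiplied by `z`, which is eventually at most B; hence ε/B.
      η = recip B ℚ.* ε
      0<η = *-pos (recip-pos 0<B) 0<ε
      N₃ , h = x≤y η 0<η
  in N₁ ℕ.⊔ (N₂ ℕ.⊔ N₃) , λ n N≤n →
    let N₁≤n , N₂₃≤n = join N₁ N≤n
        N₂≤n , N₃≤n = join N₂ N₂₃≤n
        open ℚ.≤-Reasoning
    in begin-strict
      seq z n ℚ.* seq x n                       <⟨ ℚ.*-monoʳ-<-pos (seq z n)
                                                     {{ℚ.positive (ℚ.<-≤-trans 0<δ (δ≤z n N₁≤n))}} (h n N₃≤n) ⟩
      seq z n ℚ.* (seq y n ℚ.+ η)               ≡⟨ ℚ.*-distribˡ-+ (seq z n) (seq y n) η ⟩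
      seq z n ℚ.* seq y n ℚ.+ seq z n ℚ.* η     ≤⟨ ℚ.+-monoʳ-≤ (seq z n ℚ.* seq y n)
                                                     (ℚ.*-monoʳ-≤-nonNeg η {{ℚ.nonNegative (ℚ.<⇒≤ 0<η)}}
                                                       (∣q∣≤B⇒q≤B (z≤B n N₂≤n))) ⟩
      seq z n ℚ.* seq y n ℚ.+ B ℚ.* η           ≡⟨ ≡.cong (seq z n ℚ.* seq y n ℚ.+_) (recip-inverse-* ε 0<B) ⟩
      seq z n ℚ.* seq y n ℚ.+ ε                 ∎

*-cancelˡ-≼-pos : ∀ {z x y} → Positive z → z * x ≼ z * y → x ≼ y
*-cancelˡ-≼-pos {z} {x} {y} (δ , 0<δ , N₁ , δ≤z) (less zx≤zy) = less λ ε 0<ε →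
  -- Since δ ≤ z, a slack of δ ε is at most z ε and can be absorbed into z (y + ε) before `z` is
  -- cancelled.
  let N₂ , h = zx≤zy (δ ℚ.* ε) (*-pos 0<δ 0<ε)
  in N₁ ℕ.⊔ N₂ , λ n N≤n →
    let N₁≤n , N₂≤n = join N₁ N≤n
        open ℚ.≤-Reasoning
    in ℚ.*-cancelˡ-<-nonNeg (seq z n)
         {{ℚ.nonNegative (ℚ.<⇒≤ (ℚ.<-≤-trans 0<δ (δ≤z n N₁≤n)))}} (begin-strict
      seq z n ℚ.* seq x n                       <⟨ h n N₂≤n ⟩
      seq z n ℚ.* seq y n ℚ.+ δ ℚ.* ε           ≤⟨ ℚ.+-monoʳ-≤ (seq z n ℚ.* seq y n)
                                                     (ℚ.*-monoʳ-≤-nonNeg ε {{ℚ.nonNegative (ℚ.<⇒≤ 0<ε)}}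
                                                       (δ≤z n N₁≤n)) ⟩
      seq z n ℚ.* seq y n ℚ.+ seq z n ℚ.* ε     ≡⟨ ℚ.*-distribˡ-+ (seq z n) (seq y n) ε ⟨
      seq z n ℚ.* (seq y n ℚ.+ ε)               ∎)

-- Whether `z` is zero or positive cannot be decided, so the positive case is applied to z + δ. The
-- resulting error δ (y - x) disappears in the limit.
*-monoˡ-≼ : ∀ {z x y} → 0ℝ ≼ z → x ≼ y → z * x ≼ z * y
*-monoˡ-≼ {z} {x} {y} 0≼z x≼y = ≼-limit (y + fromℚ (ℚ.- 1ℚ) * x) λ δ 0<δ → begin
  z * x                                                   ≈⟨ ≗⇒≃ (λ n → split (seq z n) (seq x n) δ) ⟩
  (z + fromℚ δ) * x + fromℚ (ℚ.- δ) * x                   ≲⟨ +-mono-≼ (*-monoˡ-≼-pos (nonneg+pos δ 0≼z 0<δ) x≼y) ≼-refl ⟩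
  (z + fromℚ δ) * y + fromℚ (ℚ.- δ) * x                   ≈⟨ ≗⇒≃ (λ n → merge (seq z n) (seq x n) (seq y n) δ) ⟩
  z * y + fromℚ δ * (y + fromℚ (ℚ.- 1ℚ) * x)              ∎
  where
  open ≼-Reasoning
  split : ∀ z x δ → z ℚ.* x ≡ (z ℚ.+ δ) ℚ.* x ℚ.+ (ℚ.- δ) ℚ.* x
  split = solve 3 (λ z x δ → z :* x := (z :+ δ) :* x :+ (:- δ) :* x) refl
  merge : ∀ z x y δ → (z ℚ.+ δ) ℚ.* y ℚ.+ (ℚ.- δ) ℚ.* x ≡ z ℚ.* y ℚ.+ δ ℚ.* (y ℚ.+ (ℚ.- 1ℚ) ℚ.* x)
  merge = solve 4 (λ z x y δ → (z :+ δ) :* y :+ (:- δ) :* x := z :* y :+ δ :* (y :+ con (ℚ.- 1ℚ) :* x)) refl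

-- Naturals, finite maxima and inverses in ℝ

fromℕ-+ : ∀ m n → fromℕ (m ℕ.+ n) ≃ fromℕ m + fromℕ n
-- Reducing a fraction involves a gcd that is stuck on variables. On unnormalised fractions with
-- denominator 1 only an integer identity remains.
fromℕ-+ m n = ≗⇒≃ λ _ → ℚ.toℚᵘ-injective (begin
  ℚ.toℚᵘ (+ (m ℕ.+ n) ℚ./ 1)                   ≈⟨ ℚ.toℚᵘ-fromℚᵘ (ℚᵘ.mkℚᵘ (+ (m ℕ.+ n)) 0) ⟩
  ℚᵘ.mkℚᵘ (+ (m ℕ.+ n)) 0                      ≈⟨ ℚᵘ.*≡* (≡.cong (ℤ._* (+ 1)) (≡.trans (ℤ.pos-+ m n)
                                                    (≡.sym (≡.cong₂ ℤ._+_ (ℤ.*-identityʳ (+ m)) (ℤ.*-identityʳ (+ n)))))) ⟩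
  ℚᵘ.mkℚᵘ (+ m) 0 ℚᵘ.+ ℚᵘ.mkℚᵘ (+ n) 0         ≈⟨ ℚᵘ.+-cong (ℚ.toℚᵘ-fromℚᵘ (ℚᵘ.mkℚᵘ (+ m) 0)) (ℚ.toℚᵘ-fromℚᵘ (ℚᵘ.mkℚᵘ (+ n) 0)) ⟨
  ℚ.toℚᵘ (+ m ℚ./ 1) ℚᵘ.+ ℚ.toℚᵘ (+ n ℚ./ 1)   ≈⟨ ℚ.toℚᵘ-homo-+ (+ m ℚ./ 1) (+ n ℚ./ 1) ⟨
  ℚ.toℚᵘ (+ m ℚ./ 1 ℚ.+ + n ℚ./ 1)             ∎)
  where open SetoidReasoning ℚᵘ.≃-setoid

fromℕ-* : ∀ m n → fromℕ (m ℕ.* n) ≃ fromℕ m * fromℕ n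
fromℕ-* zero    n = ≃-sym (zeroˡ (fromℕ n))
fromℕ-* (suc m) n = begin
  fromℕ (n ℕ.+ m ℕ.* n)              ≈⟨ fromℕ-+ n (m ℕ.* n) ⟩
  fromℕ n + fromℕ (m ℕ.* n)          ≈⟨ +-cong (≃-sym (*-identityˡ (fromℕ n))) (fromℕ-* m n) ⟩
  1ℝ * fromℕ n + fromℕ m * fromℕ n   ≈⟨ distribʳ (fromℕ n) 1ℝ (fromℕ m) ⟨
  (1ℝ + fromℕ m) * fromℕ n           ≈⟨ *-congʳ (fromℕ-+ 1 m) ⟨
  fromℕ (suc m) * fromℕ n            ∎
  where open ≃-Reasoning

fromℕ-square : ∀ n → fromℕ (n ^ 2) ≃ fromℕ n * fromℕ n
fromℕ-square n = ≃-trans (≃-reflexive (≡.cong fromℕ (≡.cong (n ℕ.*_) (ℕ.*-identityʳ n)))) (fromℕ-* n n)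

fromℕ-positive : ∀ n → Positive (fromℕ (suc n))
fromℕ-positive n = _ , ℚ.positive⁻¹ _ {{ℚ.normalize-pos (suc n) 1}} , 0 , λ _ _ → ℚ.≤-refl

≤-maximum : ∀ {n} .{{_ : NonZero n}} (v : Vector ℝ n) u → v u ≼ maximum v
-- `maximum` folds over the tail with the head as seed, so the head is followed as the seed by
-- `base` and every other entry as a folded element by `step`.
≤-maximum {suc n} v = λ { Fin.zero → base (v ∘ Fin.suc) ; (Fin.suc u) → step (v ∘ Fin.suc) u }
  where
  base : ∀ {m} (w : Vector ℝ m) → v Fin.zero ≼ foldr _⊔_ (v Fin.zero) w
  base {zero}  w = ≼-refl
  base {suc m} w = ≼-trans (base (w ∘ Fin.suc)) (pointwise⇒≼ λ n → ℚ.p≤q⊔p (seq (w Fin.zero) n) _)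
  step : ∀ {m} (w : Vector ℝ m) u → w u ≼ foldr _⊔_ (v Fin.zero) w
  step w Fin.zero    = pointwise⇒≼ λ n → ℚ.p≤p⊔q _ _
  step w (Fin.suc u) = ≼-trans (step (w ∘ Fin.suc) u) (pointwise⇒≼ λ n → ℚ.p≤q⊔p (seq (w Fin.zero) n) _)

-- As `recip` sends 0 to 0, the product is 1 only from the index on where `x` stays away from 0, so
-- `≗⇒≃` does not apply.
inverseʳ : ∀ x (x≠0 : x ≠0) → x * inverse x x≠0 ≃ 1ℝ
inverseʳ x (δ , 0<δ , N , δ≤∣x∣) = equal λ ε 0<ε → N , λ n N≤n →
  ≡.subst (ℚ._< ε)
    (≡.sym (≡.cong (λ q → ℚ.∣ q ℚ.- 1ℚ ∣)
      (recip-inverseʳ (seq x n) (bounded-away⇒≢0 0<δ (δ≤∣x∣ n N≤n))))) 0<ε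

-- Uniqueness of inverses: both sides multiply x y to 1. The witness `xy≠0` is arbitrary so that the
-- one chosen in `ratio` fits.
inverse-* : ∀ x y (x≠0 : x ≠0) (y≠0 : y ≠0) (xy≠0 : x * y ≠0) →
            inverse (x * y) xy≠0 ≃ inverse x x≠0 * inverse y y≠0
inverse-* x y x≠0 y≠0 xy≠0 = begin
  xy⁻¹                               ≈⟨ *-identityʳ xy⁻¹ ⟨
  xy⁻¹ * 1ℝ                          ≈⟨ *-congˡ (*-identityʳ 1ℝ) ⟨
  xy⁻¹ * (1ℝ * 1ℝ)                   ≈⟨ *-congˡ (*-cong (inverseʳ x x≠0) (inverseʳ y y≠0)) ⟨
  xy⁻¹ * ((x * x⁻¹) * (y * y⁻¹))     ≈⟨ ≗⇒≃ (λ n → shuffle (seq x n) (seq y n) (seq x⁻¹ n) (seq y⁻¹ n) (seq xy⁻¹ n)) ⟩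
  (x * y) * xy⁻¹ * (x⁻¹ * y⁻¹)       ≈⟨ *-congʳ (inverseʳ (x * y) xy≠0) ⟩
  1ℝ * (x⁻¹ * y⁻¹)                   ≈⟨ *-identityˡ _ ⟩
  x⁻¹ * y⁻¹                          ∎
  where
  open ≃-Reasoning
  x⁻¹ = inverse x x≠0
  y⁻¹ = inverse y y≠0
  xy⁻¹ = inverse (x * y) xy≠0
  shuffle : ∀ x y a b c → c ℚ.* ((x ℚ.* a) ℚ.* (y ℚ.* b)) ≡ (x ℚ.* y) ℚ.* c ℚ.* (a ℚ.* b)
  shuffle = solve 5 (λ x y a b c → c :* ((x :* a) :* (y :* b)) := (x :* y) :* c :* (a :* b)) refl

-- Sums and matrices

sum-mono : ∀ {n} {f g : Vector ℝ n} → (∀ i → f i ≼ g i) → sum f ≼ sum g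
sum-mono {zero}  f≼g = ≼-refl
sum-mono {suc n} f≼g = +-mono-≼ (f≼g Fin.zero) (sum-mono (f≼g ∘ Fin.suc))

sum-single : ∀ {n} (f : Vector ℝ n) i → (∀ j → j ≢ i → f j ≃ 0ℝ) → sum f ≃ f i
sum-single {suc n} f i f≃0 = begin
  sum f                         ≈⟨ sum-remove {i = i} f ⟩
  f i + sum (removeAt f i)      ≈⟨ +-congˡ (sum-cong-≋ λ j → f≃0 (Fin.punchIn i j) (Fin.punchInᵢ≢i i j)) ⟩
  f i + sum (replicate n 0ℝ)    ≈⟨ +-congˡ (sum-replicate-zero n) ⟩
  f i + 0ℝ                      ≈⟨ +-identityʳ (f i) ⟩
  f i                           ∎
  where open ≃-Reasoning

·-cong : ∀ {n} {x x′ y y′ : Vector ℝ n} → (∀ i → x i ≃ x′ i) → (∀ i → y i ≃ y′ i) → x · y ≃ x′ · y′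
·-cong x≃x′ y≃y′ = sum-cong-≋ λ i → *-cong (x≃x′ i) (y≃y′ i)

·-comm : ∀ {n} (x y : Vector ℝ n) → x · y ≃ y · x
·-comm x y = sum-cong-≋ λ i → *-comm (x i) (y i)

·-linearʳ : ∀ {n} (x u v : Vector ℝ n) s r →
            x · (λ i → s * u i + r * v i) ≃ s * (x · u) + r * (x · v)
·-linearʳ x u v s r = begin
  sum (λ i → x i * (s * u i + r * v i))
    ≈⟨ sum-cong-≋ (λ i → ≗⇒≃ λ n → expand (seq (x i) n) (seq (u i) n) (seq (v i) n) (seq s n) (seq r n)) ⟩
  sum (λ i → s * (x i * u i) + r * (x i * v i))
    ≈⟨ ∑-distrib-+ (λ i → s * (x i * u i)) (λ i → r * (x i * v i)) ⟩
  sum (λ i → s * (x i * u i)) + sum (λ i → r * (x i * v i))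
    ≈⟨ +-cong (*-distribˡ-sum s (λ i → x i * u i)) (*-distribˡ-sum r (λ i → x i * v i)) ⟨
  s * (x · u) + r * (x · v) ∎
  where
  open ≃-Reasoning
  expand : ∀ x u v s r → x ℚ.* (s ℚ.* u ℚ.+ r ℚ.* v) ≡ s ℚ.* (x ℚ.* u) ℚ.+ r ℚ.* (x ℚ.* v)
  expand = solve 5 (λ x u v s r → x :* (s :* u :+ r :* v) := s :* (x :* u) :+ r :* (x :* v)) refl

·-linearˡ : ∀ {n} (u v x : Vector ℝ n) s r →
            (λ i → s * u i + r * v i) · x ≃ s * (u · x) + r * (v · x)
·-linearˡ u v x s r = begin
  (λ i → s * u i + r * v i) · x  ≈⟨ ·-comm (λ i → s * u i + r * v i) x ⟩
  x · (λ i → s * u i + r * v i)  ≈⟨ ·-linearʳ x u v s r ⟩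
  s * (x · u) + r * (x · v)      ≈⟨ +-cong (*-congˡ (·-comm x u)) (*-congˡ (·-comm x v)) ⟩
  s * (u · x) + r * (v · x)      ∎
  where open ≃-Reasoning

*ₘ-*ᵥ-assoc : ∀ {n} (M N : Matrix n) v i → (M *ₘ N *ᵥ v) i ≃ (M *ᵥ (N *ᵥ v)) i
*ₘ-*ᵥ-assoc M N v i = begin
  sum (λ j → sum (λ l → M i l * N l j) * v j)    ≈⟨ sum-cong-≋ (λ j → *-distribʳ-sum (v j) (λ l → M i l * N l j)) ⟩
  sum (λ j → sum (λ l → M i l * N l j * v j))    ≈⟨ ∑-comm (λ j l → M i l * N l j * v j) ⟩
  sum (λ l → sum (λ j → M i l * N l j * v j))    ≈⟨ sum-cong-≋ (λ l → sum-cong-≋ λ j → *-assoc (M i l) (N l j) (v j)) ⟩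
  sum (λ l → sum (λ j → M i l * (N l j * v j)))  ≈⟨ sum-cong-≋ (λ l → *-distribˡ-sum (M i l) (λ j → N l j * v j)) ⟨
  sum (λ l → M i l * sum (λ j → N l j * v j))    ∎
  where open ≃-Reasoning

-- The quadratic form of a positive semidefinite matrix

module _ {n : ℕ} {M : Matrix n} (psd : PositiveSemidefinite M) where
  open PositiveSemidefinite psd

  -- Exchanging the two summations transposes `M`, which symmetry undoes.
  form-sym : ∀ u v → u · (M *ᵥ v) ≃ v · (M *ᵥ u)
  form-sym u v = begin
    sum (λ i → u i * sum (λ j → M i j * v j))      ≈⟨ sum-cong-≋ (λ i → *-distribˡ-sum (u i) (λ j → M i j * v j)) ⟩
    sum (λ i → sum (λ j → u i * (M i j * v j)))    ≈⟨ ∑-comm (λ i j → u i * (M i j * v j)) ⟩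
    sum (λ j → sum (λ i → u i * (M i j * v j)))    ≈⟨ sum-cong-≋ (λ j → sum-cong-≋ λ i →
                                                        *-congˡ (*-congʳ (equal (symmetric i j)))) ⟩
    sum (λ j → sum (λ i → u i * (M j i * v j)))    ≈⟨ sum-cong-≋ (λ j → sum-cong-≋ λ i →
                                                        ≗⇒≃ λ n → swap (seq (u i) n) (seq (M j i) n) (seq (v j) n)) ⟩
    sum (λ j → sum (λ i → v j * (M j i * u i)))    ≈⟨ sum-cong-≋ (λ j → *-distribˡ-sum (v j) (λ i → M j i * u i)) ⟨
    sum (λ j → v j * sum (λ i → M j i * u i))      ∎
    where
    open ≃-Reasoning
    swap : ∀ a b c → a ℚ.* (b ℚ.* c) ≡ c ℚ.* (b ℚ.* a)
    swap = solve 3 (λ a b c → a :* (b :* c) := c :* (b :* a)) refl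

  private
    Q : Vector ℝ n → ℝ
    Q v = v · (M *ᵥ v)

  Q-nonneg : ∀ v → 0ℝ ≼ Q v
  Q-nonneg v = less (nonneg v)

  -- By `form-sym` the two cross terms agree. They are kept as a sum of two copies, the shape in
  -- which `cauchy-schwarz` passes the expansion to the ring solver.
  Q-linear : ∀ u v s r → Q (λ i → s * u i + r * v i) ≃
             s * (s * Q u) + (s * r * (u · (M *ᵥ v)) + s * r * (u · (M *ᵥ v))) + r * (r * Q v)
  Q-linear u v s r = begin
    Q w                                                 ≈⟨ ·-linearˡ u v (M *ᵥ w) s r ⟩
    s * (u · (M *ᵥ w)) + r * (v · (M *ᵥ w))             ≈⟨ +-cong (*-congˡ (split u)) (*-congˡ (split v)) ⟩
    s * (s * Q u + r * b) + r * (s * (v · (M *ᵥ u)) + r * Q v)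
                                                        ≈⟨ +-congˡ (*-congˡ (+-congʳ (*-congˡ (form-sym v u)))) ⟩
    s * (s * Q u + r * b) + r * (s * b + r * Q v)       ≈⟨ ≗⇒≃ (λ n → expand (seq s n) (seq r n) (seq (Q u) n) (seq b n) (seq (Q v) n)) ⟩
    s * (s * Q u) + (s * r * b + s * r * b) + r * (r * Q v) ∎
    where
    open ≃-Reasoning
    w = λ i → s * u i + r * v i
    b = u · (M *ᵥ v)
    split : ∀ t → t · (M *ᵥ w) ≃ s * (t · (M *ᵥ u)) + r * (t · (M *ᵥ v))
    split t = ≃-trans (·-cong (λ _ → ≃-refl) λ i → ·-linearʳ (M i) u v s r)
                      (·-linearʳ t (M *ᵥ u) (M *ᵥ v) s r)
    expand : ∀ s r a b c → s ℚ.* (s ℚ.* a ℚ.+ r ℚ.* b) ℚ.+ r ℚ.* (s ℚ.* b ℚ.+ r ℚ.* c) ≡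
             s ℚ.* (s ℚ.* a) ℚ.+ (s ℚ.* r ℚ.* b ℚ.+ s ℚ.* r ℚ.* b) ℚ.+ r ℚ.* (r ℚ.* c)
    expand = solve 5 (λ s r a b c → s :* (s :* a :+ r :* b) :+ r :* (s :* b :+ r :* c) :=
                                    s :* (s :* a) :+ (s :* r :* b :+ s :* r :* b) :+ r :* (r :* c)) refl

  -- With a = Q z and b = y · M z, expand Q (s y − b z) ≥ 0 at s = a + δ and cancel
  -- s.  The shift by δ makes s invertible, as a > 0 is undecidable.
  cauchy-schwarz : ∀ y z → (y · (M *ᵥ z)) * (y · (M *ᵥ z)) ≼ Q y * Q z
  cauchy-schwarz y z = ≼-limit c λ δ 0<δ → begin
    b * b                     ≲⟨ *-cancelˡ-≼-pos (nonneg+pos δ (Q-nonneg z) 0<δ) (step δ 0<δ) ⟩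
    c * (a + fromℚ δ)         ≈⟨ ≃-trans (distribˡ c a (fromℚ δ)) (+-congˡ (*-comm c (fromℚ δ))) ⟩
    c * a + fromℚ δ * c       ∎
    where
    open ≼-Reasoning
    a = Q z
    b = y · (M *ᵥ z)
    c = Q y
    -b = fromℚ (ℚ.- 1ℚ) * b
    identity : ∀ a b c δ →
      let s = a ℚ.+ δ ; r = (ℚ.- 1ℚ) ℚ.* b in
      s ℚ.* (b ℚ.* b) ℚ.+ (s ℚ.* (s ℚ.* c) ℚ.+ (s ℚ.* r ℚ.* b ℚ.+ s ℚ.* r ℚ.* b) ℚ.+ r ℚ.* (r ℚ.* a)) ℚ.+ δ ℚ.* (b ℚ.* b)
      ≡ s ℚ.* (c ℚ.* s)
    identity = solve 4 (λ a b c δ →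
      let s = a :+ δ ; r = con (ℚ.- 1ℚ) :* b in
      s :* (b :* b) :+ (s :* (s :* c) :+ (s :* r :* b :+ s :* r :* b) :+ r :* (r :* a)) :+ δ :* (b :* b)
      := s :* (c :* s)) refl
    step : ∀ δ → 0ℚ ℚ.< δ → let s = a + fromℚ δ in s * (b * b) ≼ s * (c * s)
    step δ 0<δ = begin
      s * (b * b)                          ≲⟨ x≼x+y (Q-nonneg w) ⟩
      -- The expansion of `Q w` contains b² a = s b² - δ b². Adding δ b² compensates the shift, and
      -- the total becomes exactly s c s.
      s * (b * b) + Q w                    ≲⟨ x≼x+y 0≼δb² ⟩
      s * (b * b) + Q w + fromℚ δ * (b * b)
        ≈⟨ +-congʳ (+-congˡ (Q-linear y z s -b)) ⟩
      s * (b * b) + (s * (s * c) + (s * -b * b + s * -b * b) + -b * (-b * a)) + fromℚ δ * (b * b)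
        ≈⟨ ≗⇒≃ (λ n → identity (seq a n) (seq b n) (seq c n) δ) ⟩
      s * (c * s)                          ∎
      where
      s = a + fromℚ δ
      w = λ i → s * y i + -b * z i
      0≼δb² : 0ℝ ≼ fromℚ δ * (b * b)
      0≼δb² = begin
        0ℝ                   ≈⟨ zeroʳ (fromℚ δ) ⟨
        fromℚ δ * 0ℝ         ≲⟨ *-monoˡ-≼-pos (δ , 0<δ , 0 , λ _ _ → ℚ.≤-refl) (square-nonneg b) ⟩
        fromℚ δ * (b * b)    ∎

  module _ {M# : Matrix n} (isInv : IsGroupInverse M M#) where
    open IsGroupInverse isInv

    -- After both copies of `x` are replaced by M y, symmetry of `M` moves the left factor `M`
    -- across the product. What remains is y · M M# M y, to which `MXM≋M` applies.
    form-groupInverse : ∀ {x y} → (∀ i → x i ≃ (M *ᵥ y) i) → x · (M# *ᵥ x) ≃ y · (M *ᵥ y)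
    form-groupInverse {x} {y} x≃My = begin
      x · (M# *ᵥ x)                   ≈⟨ ·-cong x≃My (λ i → ·-cong (λ _ → ≃-refl) x≃My) ⟩
      (M *ᵥ y) · (M# *ᵥ (M *ᵥ y))     ≈⟨ ·-comm (M *ᵥ y) (M# *ᵥ (M *ᵥ y)) ⟩
      (M# *ᵥ (M *ᵥ y)) · (M *ᵥ y)     ≈⟨ form-sym (M# *ᵥ (M *ᵥ y)) y ⟩
      y · (M *ᵥ (M# *ᵥ (M *ᵥ y)))     ≈⟨ ·-cong (λ _ → ≃-refl) (λ i → *ₘ-*ᵥ-assoc M M# (M *ᵥ y) i) ⟨
      y · (M *ₘ M# *ᵥ (M *ᵥ y))       ≈⟨ ·-cong (λ _ → ≃-refl) (λ i → *ₘ-*ᵥ-assoc (M *ₘ M#) M y i) ⟨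
      y · (M *ₘ M# *ₘ M *ᵥ y)         ≈⟨ ·-cong (λ _ → ≃-refl) (λ i → ·-cong (λ j → equal (MXM≋M i j)) (λ _ → ≃-refl)) ⟩
      y · (M *ᵥ y)                    ∎
      where open ≃-Reasoning

-- Sums over subsets

-- Names the summand of `sumOver`, so that `sumOver S f` is `sum (restrict S f)` by definition; it
-- also serves to build the test vector for Cauchy-Schwarz.
restrict : ∀ {n} → Subset n → Vector ℝ n → Vector ℝ n
restrict S f u = if Vec.lookup S u then f u else 0ℝ

-- The premise is an implication so that it also covers u outside `S`, where it is vacuous.
restrict-∉ : ∀ {n} (S : Subset n) f u → (u ∈ S → f u ≃ 0ℝ) → restrict S f u ≃ 0ℝ
restrict-∉ S f u fu≃0 with Vec.lookup S u in eq
... | true  = fu≃0 (lookup⇒[]= u S eq)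
... | false = ≃-refl

restrict-∈ : ∀ {n} (S : Subset n) f {u} → u ∈ S → restrict S f u ≡ f u
restrict-∈ S f {u} u∈S rewrite []=⇒lookup u∈S = refl

restrict-mono : ∀ {n} (S : Subset n) {f g} → (∀ u → f u ≼ g u) → ∀ u → restrict S f u ≼ restrict S g u
restrict-mono S f≼g u with Vec.lookup S u
... | true  = f≼g u
... | false = ≼-refl

sumOver-const : ∀ {n} (S : Subset n) c → sumOver S (const c) ≃ fromℕ ∣ S ∣ * c
sumOver-const []          c = ≃-sym (zeroˡ c)
sumOver-const (true ∷ S)  c = begin
  c + sumOver S (const c)         ≈⟨ +-cong (≃-sym (*-identityˡ c)) (sumOver-const S c) ⟩
  1ℝ * c + fromℕ ∣ S ∣ * c        ≈⟨ distribʳ c 1ℝ (fromℕ ∣ S ∣) ⟨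
  (1ℝ + fromℕ ∣ S ∣) * c          ≈⟨ *-congʳ (fromℕ-+ 1 ∣ S ∣) ⟨
  fromℕ (suc ∣ S ∣) * c           ∎
  where open ≃-Reasoning
sumOver-const (false ∷ S) c = ≃-trans (+-identityˡ _) (sumOver-const S c)

sumOver≤∣S∣*maximum : ∀ {n} .{{_ : NonZero n}} (S : Subset n) v → sumOver S v ≼ fromℕ ∣ S ∣ * maximum v
sumOver≤∣S∣*maximum S v = ≼-trans (sum-mono (restrict-mono S (≤-maximum v))) (≃⇒≼ (sumOver-const S (maximum v)))

-- Independent sets and distance colorings

module _ {n k : ℕ} {G : Graph n} where

  ∅-independent : Independent G k ⊥
  ∅-independent i j i∈⊥ = contradiction i∈⊥ ∉⊥

  singleton-independent : ∀ u → Independent G k ⁅ u ⁆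
  singleton-independent u i j i∈ j∈ i≢j =
    contradiction (≡.trans (x∈⁅y⁆⇒x≡y u i∈) (≡.sym (x∈⁅y⁆⇒x≡y u j∈))) i≢j

  α-attained : ∃ λ S → Independent G k S × α k G ≡ ∣ S ∣
  α-attained with argmax-sel id 0 (map ∣_∣ (filter (independent? G k) (allSubsets n)))
  -- If the maximum is the default value 0, the empty set attains it.
  ... | inj₁ α≡0 = ⊥ , ∅-independent , ≡.trans α≡0 (≡.sym (∣⊥∣≡0 n))
  ... | inj₂ α∈  =
    let S , S∈ , α≡∣S∣ = ∈-map⁻ ∣_∣ α∈
    in S , proj₂ (∈-filter⁻ (independent? G k) {xs = allSubsets n} S∈) , α≡∣S∣

  -- Double counting: after the summations are exchanged, each vertex is counted only in the unique
  -- class that contains it.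
  sum-coloring : ∀ {t} {V : Vector (Subset n) t} → IsDistanceColoring k G V →
                 ∀ f → sum (λ i → sumOver (V i) f) ≃ sum f
  sum-coloring {V = V} col f = begin
    sum (λ i → sum (restrict (V i) f))            ≈⟨ ∑-comm (λ i → restrict (V i) f) ⟩
    sum (λ u → sum (λ i → restrict (V i) f u))    ≈⟨ sum-cong-≋ single ⟩
    sum f                                         ∎
    where
    open ≃-Reasoning
    open IsDistanceColoring col
    single : ∀ u → sum (λ i → restrict (V i) f u) ≃ f u
    single u = let i , u∈Vi , unique = partition u in ≃-trans
      (sum-single (λ j → restrict (V j) f u) i λ j j≢i →
        restrict-∉ (V j) f u λ u∈Vj → contradiction (≡.sym (unique u∈Vj)) j≢i)
      (≃-reflexive (restrict-∈ (V i) f u∈Vi))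

  -- The reciprocal vector of a pair in `𝓜`

  module _ {M : Matrix n} {x : Vector ℝ n} (Mx : 𝓜 k G M x) where
    open 𝓜 Mx

    reciprocal : Vector ℝ n
    reciprocal u = inverse (x u) (nonzero u)

    reciprocal·x : ∀ S → restrict S reciprocal · x ≃ fromℕ ∣ S ∣
    reciprocal·x S = begin
      restrict S reciprocal · x   ≈⟨ sum-cong-≋ term ⟩
      sumOver S (const 1ℝ)        ≈⟨ sumOver-const S 1ℝ ⟩
      fromℕ ∣ S ∣ * 1ℝ            ≈⟨ *-identityʳ (fromℕ ∣ S ∣) ⟩
      fromℕ ∣ S ∣                 ∎
      where
      open ≃-Reasoning
      term : ∀ u → restrict S reciprocal u * x u ≃ restrict S (const 1ℝ) u
      term u with Vec.lookup S u
      ... | true  = ≃-trans (*-comm (reciprocal u) (x u)) (inverseʳ (x u) (nonzero u))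
      ... | false = zeroˡ (x u)

    -- Rows of vertices outside `S` are killed by the left factor. In the row of a vertex u of `S`,
    -- an off-diagonal term for j vanishes for one of two reasons: j lies outside `S`, or
    -- independence puts j at distance more than k from u.
    form-reciprocal : ∀ {S} → Independent G k S →
                      restrict S reciprocal · (M *ᵥ restrict S reciprocal) ≃ sumOver S ratio
    form-reciprocal {S} indep = sum-cong-≋ term
      where
      open ≃-Reasoning
      z = restrict S reciprocal
      row : ∀ {u} → u ∈ S → (M *ᵥ z) u ≃ M u u * reciprocal u
      row {u} u∈S = ≃-trans
        (sum-single (λ j → M u j * z j) u offDiagonal)
        (*-congˡ (≃-reflexive (restrict-∈ S reciprocal u∈S)))
        where
        offDiagonal : ∀ j → j ≢ u → M u j * z j ≃ 0ℝ
        offDiagonal j j≢u with Vec.lookup S j in eq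
        ... | true  = ≃-trans
          (*-congʳ (equal (local u j (indep u j u∈S (lookup⇒[]= j S eq) (j≢u ∘ ≡.sym)))))
          (zeroˡ (reciprocal j))
        ... | false = zeroʳ (M u j)
      diagonal : ∀ u → reciprocal u * (M u u * reciprocal u) ≃ ratio u
      diagonal u = begin
        r * (M u u * r)    ≈⟨ *-assoc r (M u u) r ⟨
        r * M u u * r      ≈⟨ *-congʳ (*-comm r (M u u)) ⟩
        M u u * r * r      ≈⟨ *-assoc (M u u) r r ⟩
        M u u * (r * r)    ≈⟨ *-congˡ (inverse-* (x u) (x u) (nonzero u) (nonzero u) _) ⟨
        ratio u            ∎
        where r = reciprocal u
      term : ∀ u → z u * (M *ᵥ z) u ≃ restrict S ratio u
      term u with Vec.lookup S u in eq
      ... | true  = ≃-trans (*-congˡ (row (lookup⇒[]= u S eq))) (diagonal u)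
      ... | false = zeroˡ ((M *ᵥ z) u)

    -- The three bounds

    module _ {M# : Matrix n} (isInv : IsGroupInverse M M#) where

      energy : ℝ
      energy = x · (M# *ᵥ x)

      private
        y = proj₁ inRange

        x≃My : ∀ i → x i ≃ (M *ᵥ y) i
        x≃My i = equal (proj₂ inRange i)

        energy≃ : energy ≃ y · (M *ᵥ y)
        energy≃ = form-groupInverse psd isInv x≃My

      -- The value is that of the form of `M` at `y`, where semidefiniteness applies. This allows
      -- `cardinality-bound` to multiply an inequality by `energy`.
      energy-nonneg : 0ℝ ≼ energy
      energy-nonneg = ≼-trans (Q-nonneg psd y) (≃⇒≼ (≃-sym energy≃))

      independent-bound : ∀ {S} → Independent G k S → fromℕ ∣ S ∣ * fromℕ ∣ S ∣ ≼ energy * sumOver S ratio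
      independent-bound {S} indep = begin
        fromℕ ∣ S ∣ * fromℕ ∣ S ∣                ≈⟨ *-cong yMz yMz ⟨
        (y · (M *ᵥ z)) * (y · (M *ᵥ z))          ≲⟨ cauchy-schwarz psd y z ⟩
        (y · (M *ᵥ y)) * (z · (M *ᵥ z))          ≈⟨ *-cong (≃-sym energy≃) (form-reciprocal indep) ⟩
        energy * sumOver S ratio                 ∎
        where
        open ≼-Reasoning
        z = restrict S reciprocal
        yMz : y · (M *ᵥ z) ≃ fromℕ ∣ S ∣
        yMz = ≃-trans (form-sym psd y z) (≃-trans
          (·-cong (λ _ → ≃-refl) (λ i → ≃-sym (x≃My i))) (reciprocal·x S))

      -- Bounding every ratio by the maximum turns `independent-bound` into s² ≤ energy · s ·
      -- maximum with s the size of `S`. Writing the size as a successor makes s positive, so one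
      -- factor cancels.
      cardinality-bound : .{{_ : NonZero n}} → ∀ {S m} → Independent G k S → ∣ S ∣ ≡ suc m →
                          fromℕ (suc m) ≼ energy * maximum ratio
      cardinality-bound {S} {m} indep ∣S∣≡1+m = *-cancelˡ-≼-pos (fromℕ-positive m) (begin
        s * s                          ≈⟨ *-cong s≃ s≃ ⟩
        fromℕ ∣ S ∣ * fromℕ ∣ S ∣      ≲⟨ independent-bound indep ⟩
        energy * sumOver S ratio       ≲⟨ *-monoˡ-≼ energy-nonneg (sumOver≤∣S∣*maximum S ratio) ⟩
        energy * (fromℕ ∣ S ∣ * maximum ratio)  ≈⟨ *-congˡ (*-congʳ s≃) ⟨
        energy * (s * maximum ratio)   ≈⟨ *-assoc energy s (maximum ratio) ⟨
        energy * s * maximum ratio     ≈⟨ *-congʳ (*-comm energy s) ⟩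
        s * energy * maximum ratio     ≈⟨ *-assoc s energy (maximum ratio) ⟩
        s * (energy * maximum ratio)   ∎)
        where
        open ≼-Reasoning
        s = fromℕ (suc m)
        s≃ : s ≃ fromℕ ∣ S ∣
        s≃ = ≃-reflexive (≡.cong fromℕ (≡.sym ∣S∣≡1+m))

      -- ∣ S ∣ = 0 cannot be cancelled; a singleton then gives a larger lower bound.
      α-bound : .{{_ : NonZero n}} → ∀ {S} m → Independent G k S → ∣ S ∣ ≡ m →
                Fin n → fromℕ m ≼ energy * maximum ratio
      α-bound (suc m) indep ∣S∣≡ u = cardinality-bound indep ∣S∣≡
      α-bound zero    _     _    u = begin
        fromℕ 0                  ≲⟨ pointwise⇒≼ (λ _ → ℚ.<⇒≤ (ℚ.positive⁻¹ 1ℚ)) ⟩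
        fromℕ 1                  ≲⟨ cardinality-bound (singleton-independent u) (∣⁅x⁆∣≡1 u) ⟩
        energy * maximum ratio   ∎
        where open ≼-Reasoning

      -- The bounds for the single classes share the factor `energy`, and their remaining sums
      -- together run over every vertex once.
      coloring-bound : ∀ {t} {V : Vector (Subset n) t} → IsDistanceColoring k G V →
                       sum (λ i → fromℕ (∣ V i ∣ ^ 2)) ≼ energy * sum ratio
      coloring-bound {V = V} col = begin
        sum (λ i → fromℕ (∣ V i ∣ ^ 2))              ≲⟨ sum-mono (λ i → ≼-trans (≃⇒≼ (fromℕ-square ∣ V i ∣))
                                                          (independent-bound (IsDistanceColoring.independent col i))) ⟩
        sum (λ i → energy * sumOver (V i) ratio)     ≈⟨ *-distribˡ-sum energy (λ i → sumOver (V i) ratio) ⟨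
        energy * sum (λ i → sumOver (V i) ratio)     ≈⟨ *-congˡ (sum-coloring col ratio) ⟩
        energy * sum ratio                           ∎
        where open ≼-Reasoning

theorem5 : (k : ℕ) .{{_ : NonZero k}} (n : ℕ) .{{_ : NonZero n}}
    (G : Graph n) (M : Matrix n) (x : Vector ℝ n) (Mx : 𝓜 k G M x)
    (M# : Matrix n) → IsGroupInverse M M# →
    let open 𝓜 Mx using (ratio) in
    ((S : Subset n) → Independent G k S →
    fromℕ (∣ S ∣ ^ 2) ≤ (x · (M# *ᵥ x)) * sumOver S ratio)
    × fromℕ (α k G) ≤ (x · (M# *ᵥ x)) * maximum ratio
    × ((t : ℕ) (V : Vector (Subset n) t) → IsDistanceColoring k G V →
    sum (λ i → fromℕ (∣ V i ∣ ^ 2)) ≤ (x · (M# *ᵥ x)) * sum ratio)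
theorem5 k n@(suc _) G M x Mx M# isInv =
    (λ S indep → unwrap (≼-trans (≃⇒≼ (fromℕ-square ∣ S ∣)) (independent-bound Mx isInv indep)))
  -- Matching n with a successor provides the vertex `Fin.zero`, from which `α-bound` forms a
  -- singleton if the maximum is 0.
  , (let S , indep , α≡∣S∣ = α-attained {k = k} {G = G}
     in unwrap (α-bound Mx isInv (α k G) indep (≡.sym α≡∣S∣) Fin.zero))
  , (λ t V col → unwrap (coloring-bound Mx isInv col))
  where open _≼_
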